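{- Let $F$ be a forest on $t$ vertices and let $t'$ be the maximum number of vertices in a connected component of $F$. For every positive integer $k$ and every graph $G$, either $G$ contains $k$ pairwise vertex-disjoint subgraphs each having an $F$ minor, or there exists a set $X$ of at most $tk-t'$ vertices of $G$ such that $G-X$ has no $F$ minor.
   Context: All graphs are finite. A graph $H$ is a minor of a graph $G$ if $H$ can be obtained from a subgraph of $G$ by contracting edges. For $X\subseteq V(G)$, $G-X$ denotes the subgraph of $G$ induced by $V(G)\setminus X$. -}

module Defs where

open import Data.Nat using (ℕ; zero; suc; _≤_; _*_; _∸_)
open import Data.Bool using (Bool; true; false)
open import Data.Fin using (Fin; zero; suc; inject₁; fromℕ)
open import Data.Fin.Subset using (Subset; _∈_; ∁; ∣_∣)
open import Data.Product using (Σ; ∃; ∃₂; _×_; _,_)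
open import Data.Sum using (_⊎_)
open import Data.Empty using (⊥)
open import Relation.Nullary using (¬_)
open import Relation.Binary.PropositionalEquality using (_≡_; _≢_)
open import Function.Definitions using (Injective)

record Graph : Set where
  field
    n      : ℕ
    adj    : Fin n → Fin n → Bool
    sym    : ∀ u v → adj u v ≡ adj v u
    irrefl : ∀ v → adj v v ≡ false

open Graph public

V : Graph → Set
V G = Fin (n G)

Edge : (G : Graph) → V G → V G → Set
Edge G u v = adj G u v ≡ true

data Walk (G : Graph) (A : V G → Set) : V G → V G → Set where
  here : ∀ {v} → Walk G A v v
  step : ∀ {u w v} → Edge G u w → A w → Walk G A w v → Walk G A u v

record Cycle (G : Graph) : Set where
  field
    m     : ℕ
    f     : Fin (suc (suc (suc m))) → V G
    inj   : Injective _≡_ _≡_ f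
    edges : ∀ (i : Fin (suc (suc m))) → Edge G (f (inject₁ i)) (f (suc i))
    close : Edge G (f (fromℕ (suc (suc m)))) (f zero)

IsForest : Graph → Set
IsForest G = ¬ Cycle G

HasCard : {N : ℕ} → (Fin N → Set) → ℕ → Set
HasCard {N} P c =
  Σ (Fin c → Fin N) λ g → Injective _≡_ _≡_ g × (∀ u → (P u → ∃ λ i → g i ≡ u) × (∀ i → g i ≡ u → P u))

Component : (G : Graph) → V G → V G → Set
Component G v u = Walk G (λ _ → ⊤′) v u
  where
  open import Data.Unit using () renaming (⊤ to ⊤′)

MaxComponentSize : Graph → ℕ → Set
MaxComponentSize G c =
  (∀ v d → HasCard (Component G v) d → d ≤ c) ×
  ((n G ≡ 0 × c ≡ 0) ⊎ (∃ λ v → HasCard (Component G v) c))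

-- A minor model of H in the induced subgraph G[A] (branch sets inside A).
-- H is a minor of G[A] iff such a model exists.
record MinorModel (G H : Graph) (A : Subset (n G)) : Set where
  field
    branch    : V H → Subset (n G)
    inside    : ∀ x v → v ∈ branch x → v ∈ A
    nonempty  : ∀ x → ∃ λ v → v ∈ branch x
    disjoint  : ∀ x y v → x ≢ y → v ∈ branch x → v ∈ branch y → ⊥
    connected : ∀ x u v → u ∈ branch x → v ∈ branch x → Walk G (_∈ branch x) u v
    edges     : ∀ x y → Edge H x y →
                ∃₂ λ u v → u ∈ branch x × v ∈ branch y × Edge G u v

HasMinor : (G : Graph) → Subset (n G) → Graph → Set
HasMinor G A H = MinorModel G H A

-- G contains k pairwise vertex-disjoint subgraphs each having an H minor
-- (taken as induced subgraphs G[S i] on pairwise disjoint vertex sets S i).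
DisjointMinors : (G H : Graph) → ℕ → Set
DisjointMinors G H k =
  Σ (Fin k → Subset (n G)) λ S →
    (∀ i j v → i ≢ j → v ∈ S i → v ∈ S j → ⊥) ×
    (∀ i → HasMinor G (S i) H)

{-# OPTIONS --safe #-}
module Submission where

-- List k copies of every component of F and pack them one at a time. If the rest U of G contains
-- some tree of the list L, then it has a set A with a separator S ⊇ ∂A of at most min |C| vertices,
-- C in L, such that A contains some T in L but A ∖ S contains none. Use A for T and go on in U ∖ A
-- with L minus T. When this gets stuck, all separators together hit some tree of L, and the i-th of
-- them is no larger than the i-th smallest tree of the list, so the largest one is not paid for.
--
-- The pair (A, S) is found as in Diestel's proof that graphs of large path-width contain every
-- forest: if there is none, then adding a vertex to a set X with |∂X| < |C| containing no tree of L
-- yields such a set again. Starting from sets that are maximal with respect to X ⊆ Y, |∂Y| ≤ |∂X|,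
-- a model of C is grown vertex by vertex, its branch sets being rooted at the vertices of ∂X, and
-- Menger's theorem carries the roots to the boundary of the next maximal set.

open import Defs
open import Data.Nat using (ℕ; _≤_; _*_; _∸_)
open import Data.Fin.Subset using (Subset; ∁; ∣_∣)
open import Data.Product using (Σ; _×_)
open import Data.Sum using (_⊎_)
open import Relation.Nullary using (¬_)

open import Data.Bool using (true; false; if_then_else_)
open import Data.Bool.Properties using () renaming (_≟_ to _≟ᵇ_)
open import Data.Empty using (⊥-elim)
open import Data.Fin using (Fin; zero; suc; inject₁; fromℕ)
open import Data.Fin.Properties using (_≟_; any?; all?; suc-injective)
open import Data.Fin.Subset using (_∈_; _∉_; _⊆_; _∪_; _─_; _-_; ⁅_⁆; ⊤; ⊥; Nonempty; Empty)
open import Data.Fin.Subset.Properties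
open import Data.List using (List; []; _∷_; _++_; concat; length; map; replicate)
open import Data.List.Extrema.Nat using (argmin; argmin-sel; f[argmin]≤f[⊤]; f[argmin]≤f[xs])
open import Data.List.Membership.Propositional using (find; lose) renaming (_∈_ to _∈ˡ_)
open import Data.List.Membership.Propositional.Properties using (∈-++⁺ˡ)
open import Data.List.Properties using (map-++)
open import Data.List.Relation.Unary.All as All using (All; []; _∷_)
open import Data.List.Relation.Unary.All.Properties using (concat⁺; replicate⁺)
open import Data.List.Relation.Unary.Any as Any using (Any; here; there)
open import Data.Nat using (zero; suc; _+_; _<_; z≤n; s≤s; s≤s⁻¹)
open import Data.Nat.ListAction using (sum)
open import Data.Nat.ListAction.Properties using (sum-++)
open import Data.Nat.Properties hiding (_≟_; suc-injective)
open import Data.Product using (∃; ∃₂; _,_; proj₁; proj₂)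
open import Data.Sum using (inj₁; inj₂; [_,_]′)
import Data.Sum as Sum
open import Data.Unit using (tt) renaming (⊤ to Unit)
open import Data.Vec using (Vec; []; _∷_; lookup; tabulate)
open import Data.Vec.Properties using (lookup∘tabulate; lookup⇒[]=; []=⇒lookup)
open import Function using (_∘_; id)
open import Function.Definitions using (Injective)
open import Relation.Binary.PropositionalEquality using (_≡_; _≢_; refl; trans; cong; subst) renaming (sym to ≡-sym)
open import Relation.Nullary using (Dec; yes; no; does; contradiction)
open import Relation.Nullary.Decidable using (map′; ¬?; _×-dec_; _→-dec_; dec-true; decidable-stable)
open import Relation.Unary using (Decidable)

-- Finite sets

module _ {N : ℕ} {P : Fin N → Set} (P? : Decidable P) where

  comprehension : Subset N
  comprehension = tabulate (does ∘ P?)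

  ∈-comprehension⁺ : ∀ {x} → P x → x ∈ comprehension
  ∈-comprehension⁺ {x} px =
    lookup⇒[]= x _ (trans (lookup∘tabulate (does ∘ P?) x) (dec-true (P? x) px))

  ∈-comprehension⁻ : ∀ {x} → x ∈ comprehension → P x
  ∈-comprehension⁻ {x} x∈ with P? x | trans (≡-sym (lookup∘tabulate (does ∘ P?) x)) ([]=⇒lookup x∈)
  ... | yes px | _ = px

x∈p─q⇒x∉q : ∀ {N x} (p q : Subset N) → x ∈ p ─ q → x ∉ q
x∈p─q⇒x∉q p q x∈p─q x∈q with x∈p─q | x∈q
x∈p─q⇒x∉q (_ ∷ p) (_ ∷ q) _ _ | Data.Vec.there x∈p─q | Data.Vec.there x∈q = x∈p─q⇒x∉q p q x∈p─q x∈q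

∣p∪q∣≤∣p∣+∣q∣ : ∀ {N} (p q : Subset N) → ∣ p ∪ q ∣ ≤ ∣ p ∣ + ∣ q ∣
∣p∪q∣≤∣p∣+∣q∣ [] [] = z≤n
∣p∪q∣≤∣p∣+∣q∣ (false ∷ p) (false ∷ q) = ∣p∪q∣≤∣p∣+∣q∣ p q
∣p∪q∣≤∣p∣+∣q∣ (false ∷ p) (true ∷ q) = subst (suc ∣ p ∪ q ∣ ≤_) (≡-sym (+-suc ∣ p ∣ ∣ q ∣)) (s≤s (∣p∪q∣≤∣p∣+∣q∣ p q))
∣p∪q∣≤∣p∣+∣q∣ (true ∷ p) (false ∷ q) = s≤s (∣p∪q∣≤∣p∣+∣q∣ p q)
∣p∪q∣≤∣p∣+∣q∣ (true ∷ p) (true ∷ q) = s≤s (≤-trans (∣p∪q∣≤∣p∣+∣q∣ p q) (+-monoʳ-≤ ∣ p ∣ (n≤1+n ∣ q ∣)))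

∣p∪⁅x⁆∣≤1+∣p∣ : ∀ {N} (p : Subset N) x → ∣ p ∪ ⁅ x ⁆ ∣ ≤ suc ∣ p ∣
∣p∪⁅x⁆∣≤1+∣p∣ p x = ≤-trans (∣p∪q∣≤∣p∣+∣q∣ p ⁅ x ⁆)
  (≤-reflexive (trans (cong (∣ p ∣ +_) (∣⁅x⁆∣≡1 x)) (+-comm ∣ p ∣ 1)))

∣q∣+∣p─q∣≤∣p∣ : ∀ {N} (p q : Subset N) → q ⊆ p → ∣ q ∣ + ∣ p ─ q ∣ ≤ ∣ p ∣
∣q∣+∣p─q∣≤∣p∣ [] [] _ = z≤n
∣q∣+∣p─q∣≤∣p∣ (false ∷ p) (false ∷ q) q⊆p = ∣q∣+∣p─q∣≤∣p∣ p q (drop-∷-⊆ q⊆p)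
∣q∣+∣p─q∣≤∣p∣ (false ∷ p) (true ∷ q) q⊆p with q⊆p Data.Vec.here
... | ()
∣q∣+∣p─q∣≤∣p∣ (true ∷ p) (false ∷ q) q⊆p = subst (_≤ suc ∣ p ∣) (≡-sym (+-suc ∣ q ∣ ∣ p ─ q ∣)) (s≤s (∣q∣+∣p─q∣≤∣p∣ p q (drop-∷-⊆ q⊆p)))
∣q∣+∣p─q∣≤∣p∣ (true ∷ p) (true ∷ q) q⊆p = s≤s (∣q∣+∣p─q∣≤∣p∣ p q (drop-∷-⊆ q⊆p))

p⊆q∧∣q∣≤∣p∣⇒q⊆p : ∀ {N} {p q : Subset N} → p ⊆ q → ∣ q ∣ ≤ ∣ p ∣ → q ⊆ p
p⊆q∧∣q∣≤∣p∣⇒q⊆p {p = p} p⊆q ∣q∣≤∣p∣ {x} x∈q with x ∈? p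
... | yes x∈p = x∈p
... | no x∉p = contradiction ∣q∣≤∣p∣ (<⇒≱ (p⊂q⇒∣p∣<∣q∣ (p⊆q , x , x∈q , x∉p)))

⊆-∪⁅⁆ : ∀ {N} {p q : Subset N} {x} → p ⊆ q → x ∈ q → p ∪ ⁅ x ⁆ ⊆ q
⊆-∪⁅⁆ {p = p} {x = x} p⊆q x∈q y∈ with x∈p∪q⁻ p ⁅ x ⁆ y∈
... | inj₁ y∈p = p⊆q y∈p
... | inj₂ y∈x rewrite x∈⁅y⁆⇒x≡y x y∈x = x∈q

x∈p∪⁅x⁆ : ∀ {N} (p : Subset N) x → x ∈ p ∪ ⁅ x ⁆
x∈p∪⁅x⁆ p x = q⊆p∪q p ⁅ x ⁆ (x∈⁅x⁆ x)

x∉p⇒∣p∣<∣p∪⁅x⁆∣ : ∀ {N} {p : Subset N} {x} → x ∉ p → ∣ p ∣ < ∣ p ∪ ⁅ x ⁆ ∣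
x∉p⇒∣p∣<∣p∪⁅x⁆∣ {p = p} {x} x∉p = p⊂q⇒∣p∣<∣q∣ (p⊆p∪q ⁅ x ⁆ , x , x∈p∪⁅x⁆ p x , x∉p)

y∈p∪⁅x⁆∧y≢x⇒y∈p : ∀ {N} (p : Subset N) {x y} → y ∈ p ∪ ⁅ x ⁆ → y ≢ x → y ∈ p
y∈p∪⁅x⁆∧y≢x⇒y∈p p {x} y∈ y≢x =
  [ id , (λ y∈x → contradiction (x∈⁅y⁆⇒x≡y x y∈x) y≢x) ]′ (x∈p∪q⁻ p ⁅ x ⁆ y∈)

injection⇒≤∣p∣ : ∀ {N c} (p : Subset N) (g : Fin c → Fin N) → Injective _≡_ _≡_ g →
  (∀ i → g i ∈ p) → c ≤ ∣ p ∣
injection⇒≤∣p∣ {c = zero} p g g-inj g∈ = z≤n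
injection⇒≤∣p∣ {c = suc c} p g g-inj g∈ = ≤-<-trans
  (injection⇒≤∣p∣ (p - g zero) (g ∘ suc) (suc-injective ∘ g-inj)
    (λ i → x∈p∧x≢y⇒x∈p-y (g∈ (suc i)) (λ eq → contradiction (g-inj eq) λ ())))
  (x∈p⇒∣p-x∣<∣p∣ (g∈ zero))

-- Families of branch sets are searched as vectors of subsets, which makes the existence of a minor
-- model decidable.
anyVec? : ∀ {N} m {P : Vec (Subset N) m → Set} → Decidable P → Dec (∃ P)
anyVec? zero P? = map′ (λ p → [] , p) (λ { ([] , p) → p }) (P? [])
anyVec? (suc m) P? = map′ (λ (B , Bs , p) → B ∷ Bs , p) (λ { (B ∷ Bs , p) → B , Bs , p })
  (anySubset? λ B → anyVec? m λ Bs → P? (B ∷ Bs))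

-- In the searches below, N bounds how often a set of size c can still grow within a set of size m.
spend : ∀ {m N c d} → m ≤ suc N + c → c < d → m ≤ N + d
spend {N = N} {c} bound c<d = ≤-trans bound (≤-trans (≤-reflexive (≡-sym (+-suc N c))) (+-monoʳ-≤ N c<d))

-- Walks

edge? : (G : Graph) → ∀ u v → Dec (Edge G u v)
edge? G u v = adj G u v ≟ᵇ true

edge-sym : (G : Graph) → ∀ {u v} → Edge G u v → Edge G v u
edge-sym G {u} {v} e = trans (sym G v u) e

edge-irrefl : (G : Graph) → ∀ {u} → ¬ Edge G u u
edge-irrefl G {u} e with trans (≡-sym e) (irrefl G u)
... | ()

module _ {G : Graph} where

  walk-map : ∀ {A B : V G → Set} → (∀ {v} → A v → B v) → ∀ {u v} → Walk G A u v → Walk G B u v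
  walk-map f here = here
  walk-map f (step e a p) = step e (f a) (walk-map f p)

  walk-++ : ∀ {A u v w} → Walk G A u v → Walk G A v w → Walk G A u w
  walk-++ here q = q
  walk-++ (step e a p) q = step e a (walk-++ p q)

  walk-reverse : ∀ {A u v} → A u → Walk G A u v → Walk G A v u
  walk-reverse a here = here
  walk-reverse a (step e b p) = walk-++ (walk-reverse b p) (step (edge-sym G e) a here)

  walk-preserves : ∀ {A K : V G → Set} → (∀ {u v} → A u → A v → Edge G u v → K u → K v) →
    ∀ {u v} → A u → Walk G A u v → K u → K v
  walk-preserves k a here ku = ku
  walk-preserves k a (step e b p) ku = walk-preserves k b p (k a b e ku)

-- Reachability and connected sets

Closed : (G : Graph) → (V G → Set) → Subset (n G) → Set
Closed G A R = ∀ {u v} → u ∈ R → Edge G u v → A v → v ∈ R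

closed-walk : ∀ {G A R u v} → Closed G A R → u ∈ R → Walk G A u v → v ∈ R
closed-walk closed u∈R here = u∈R
closed-walk closed u∈R (step e a p) = closed-walk closed (closed u∈R e a) p

closed-walk-inside : ∀ {G A R u v} → Closed G A R → u ∈ R → Walk G A u v → Walk G (_∈ R) u v
closed-walk-inside closed u∈R here = here
closed-walk-inside closed u∈R (step e a p) =
  step e (closed u∈R e a) (closed-walk-inside closed (closed u∈R e a) p)

module _ (G : Graph) {A : V G → Set} (A? : Decidable A) (u : V G) where

  ReachableSet : Subset (n G) → Set
  ReachableSet R = u ∈ R × (∀ {v} → v ∈ R → Walk G A u v) × Closed G A R

  reach-from : ∀ N R → n G ≤ N + ∣ R ∣ → u ∈ R → (∀ {v} → v ∈ R → Walk G A u v) → ∃ ReachableSet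
  reach-from N R bound u∈R walks
    with any? (λ v → any? λ w → v ∈? R ×-dec edge? G v w ×-dec A? w ×-dec ¬? (w ∈? R))
  ... | no none = R , u∈R , walks , λ {v} {w} v∈R e a →
          decidable-stable (w ∈? R) λ w∉R → none (v , w , v∈R , e , a , w∉R)
  reach-from zero R bound u∈R walks | yes (v , w , v∈R , e , a , w∉R) =
    contradiction (≤-trans (∣p∣≤n (R ∪ ⁅ w ⁆)) bound) (<⇒≱ (x∉p⇒∣p∣<∣p∪⁅x⁆∣ w∉R))
  reach-from (suc N) R bound u∈R walks | yes (v , w , v∈R , e , a , w∉R) =
    reach-from N (R ∪ ⁅ w ⁆)
      (spend bound (x∉p⇒∣p∣<∣p∪⁅x⁆∣ w∉R))
      (p⊆p∪q ⁅ w ⁆ u∈R) walks′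
    where
    walks′ : ∀ {x} → x ∈ R ∪ ⁅ w ⁆ → Walk G A u x
    walks′ x∈ with x∈p∪q⁻ R ⁅ w ⁆ x∈
    ... | inj₁ x∈R = walks x∈R
    ... | inj₂ x∈w rewrite x∈⁅y⁆⇒x≡y w x∈w = walk-++ (walks v∈R) (step e a here)

  reach : ∃ ReachableSet
  reach = reach-from (n G) ⁅ u ⁆ (m≤m+n (n G) _) (x∈⁅x⁆ u) start
    where
    start : ∀ {v} → v ∈ ⁅ u ⁆ → Walk G A u v
    start v∈ rewrite x∈⁅y⁆⇒x≡y u v∈ = here

  walk? : ∀ v → Dec (Walk G A u v)
  walk? v with reach
  ... | R , u∈R , walks , closed = map′ walks (closed-walk closed u∈R) (v ∈? R)

Connected : (G : Graph) → Subset (n G) → Set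
Connected G B = ∀ {u v} → u ∈ B → v ∈ B → Walk G (_∈ B) u v

connected? : ∀ G B → Dec (Connected G B)
connected? G B = map′ (λ f {u} {v} → f u v) (λ f u v → f)
  (all? λ u → all? λ v → u ∈? B →-dec v ∈? B →-dec walk? G (_∈? B) u v)

connected-∪⁅⁆ : ∀ {G B u v} → Connected G B → u ∈ B → Edge G u v → Connected G (B ∪ ⁅ v ⁆)
connected-∪⁅⁆ {G} {B} {u} {v} conn u∈B e a∈ b∈ =
  walk-++ (walk-reverse (p⊆p∪q ⁅ v ⁆ u∈B) (from-u a∈)) (from-u b∈)
  where
  from-u : ∀ {w} → w ∈ B ∪ ⁅ v ⁆ → Walk G (_∈ B ∪ ⁅ v ⁆) u w
  from-u w∈ with x∈p∪q⁻ B ⁅ v ⁆ w∈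
  ... | inj₁ w∈B = walk-map (p⊆p∪q ⁅ v ⁆) (conn u∈B w∈B)
  ... | inj₂ w∈v rewrite x∈⁅y⁆⇒x≡y v w∈v = step e (x∈p∪⁅x⁆ B v) here

connected-⁅⁆ : ∀ {G} v → Connected G ⁅ v ⁆
connected-⁅⁆ v a∈ b∈ rewrite x∈⁅y⁆⇒x≡y v a∈ | x∈⁅y⁆⇒x≡y v b∈ = here

connected-exit : ∀ {G B P} → Connected G B → Nonempty P → P ⊆ B → ∀ {x} → x ∈ B → x ∉ P →
  ∃₂ λ p q → p ∈ P × q ∈ B × q ∉ P × Edge G p q
connected-exit {G} {B} {P} conn (p , p∈P) P⊆B x∈B x∉P = exit p∈P (conn (P⊆B p∈P) x∈B)
  where
  exit : ∀ {p} → p ∈ P → Walk G (_∈ B) p _ → ∃₂ λ p q → p ∈ P × q ∈ B × q ∉ P × Edge G p q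
  exit p∈P here = contradiction p∈P x∉P
  exit p∈P (step {w = q} e q∈B walk) with q ∈? P
  ... | yes q∈P = exit q∈P walk
  ... | no q∉P = _ , q , p∈P , q∈B , q∉P , e

-- Cycles

record SimplePath (G : Graph) (A : V G → Set) (u v : V G) : Set where
  field
    len   : ℕ
    f     : Fin (suc len) → V G
    inj   : Injective _≡_ _≡_ f
    edges : ∀ i → Edge G (f (inject₁ i)) (f (suc i))
    all   : ∀ i → A (f i)
    start : f zero ≡ u
    end   : f (fromℕ len) ≡ v

module _ {G : Graph} where
  open SimplePath

  _◂_ : ∀ {m} → V G → (Fin m → V G) → Fin (suc m) → V G
  (u ◂ f) zero = u
  (u ◂ f) (suc i) = f i

  ◂-injective : ∀ {m u} {f : Fin m → V G} → (∀ i → f i ≢ u) → Injective _≡_ _≡_ f →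
    Injective _≡_ _≡_ (u ◂ f)
  ◂-injective new inj {zero} {zero} eq = refl
  ◂-injective new inj {zero} {suc j} eq = contradiction (≡-sym eq) (new j)
  ◂-injective new inj {suc i} {zero} eq = contradiction eq (new i)
  ◂-injective new inj {suc i} {suc j} eq = cong suc (inj eq)

  suffix : ∀ {A v} len (f : Fin (suc len) → V G) → Injective _≡_ _≡_ f →
    (∀ i → Edge G (f (inject₁ i)) (f (suc i))) → (∀ i → A (f i)) → f (fromℕ len) ≡ v →
    ∀ i → SimplePath G A (f i) v
  suffix len f inj es as end zero = record
    { len = len ; f = f ; inj = inj ; edges = es ; all = as ; start = refl ; end = end }
  suffix (suc len) f inj es as end (suc i) =
    suffix len (f ∘ suc) (suc-injective ∘ inj) (es ∘ suc) (as ∘ suc) end i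

  -- If `u` already lies on the simple path built for the rest of the walk, the part of that path
  -- from `u` on is taken; otherwise `u` is put in front.
  simple-path : ∀ {A u v} → A u → Walk G A u v → SimplePath G A u v
  simple-path {u = u} a here = record
    { len = 0 ; f = λ _ → u ; inj = λ { {zero} {zero} _ → refl } ; edges = λ () ; all = λ _ → a
    ; start = refl ; end = refl }
  simple-path {A} {u} {v} a (step e b walk) with simple-path b walk
  ... | p with any? (λ i → f p i ≟ u)
  ...   | yes (i , eq) = subst (λ w → SimplePath G A w v) eq
            (suffix (len p) (f p) (inj p) (edges p) (all p) (end p) i)
  ...   | no new = record
            { len = suc (len p) ; f = u ◂ f p ; inj = ◂-injective (λ i eq → new (i , eq)) (inj p)
            ; edges = λ { zero → subst (Edge G u) (≡-sym (start p)) e ; (suc i) → edges p i }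
            ; all = λ { zero → a ; (suc i) → all p i } ; start = refl ; end = end p }

  -- Distinct `a` and `b` would be joined by a simple path inside `P`, which `q` closes to a cycle.
  -- Hence a new tree vertex has to be attached to only one vertex already placed.
  forest-unique-neighbour : IsForest G → ∀ {P} → Connected G P → ∀ {q a b} → q ∉ P → a ∈ P → b ∈ P →
    Edge G q a → Edge G q b → a ≡ b
  forest-unique-neighbour forest {P} conn {q} {a} {b} q∉P a∈P b∈P qa qb
    with simple-path a∈P (conn a∈P b∈P)
  ... | record { len = zero ; start = refl ; end = refl } = refl
  ... | record { len = suc m ; f = f ; inj = inj ; edges = es ; all = as ; start = refl ; end = refl } =
    contradiction
      (record
        { m = m ; f = q ◂ f ; inj = ◂-injective (λ i eq → q∉P (subst (_∈ P) eq (as i))) inj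
        ; edges = λ { zero → qa ; (suc i) → es i } ; close = edge-sym G qb })
      forest

-- Minor models

_[_↦_] : ∀ {N} {T : Set} → (Fin N → T) → Fin N → T → Fin N → T
(f [ q ↦ t ]) x = if does (x ≟ q) then t else f x

-- Every vertex of `F` gets a branch set, but only those at `C` are constrained, so restricting or
-- extending a model does not change the type of `branch`.
record IsModel (F G : Graph) (branch : V F → Subset (n G)) (C : Subset (n F)) (A : Subset (n G)) : Set where
  field
    inside    : ∀ {x v} → x ∈ C → v ∈ branch x → v ∈ A
    nonempty  : ∀ {x} → x ∈ C → Nonempty (branch x)
    disjoint  : ∀ {x y v} → x ∈ C → y ∈ C → v ∈ branch x → v ∈ branch y → x ≡ y
    connected : ∀ {x} → x ∈ C → Connected G (branch x)
    edges     : ∀ {x y} → x ∈ C → y ∈ C → Edge F x y →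
                ∃₂ λ u v → u ∈ branch x × v ∈ branch y × Edge G u v

-- A minor model in G[A] of the subgraph F[C].
Model : (F G : Graph) → Subset (n F) → Subset (n G) → Set
Model F G C A = ∃ λ branch → IsModel F G branch C A

module _ {F G : Graph} where
  open IsModel

  isModel-mono : ∀ {branch C C′ A A′} → C′ ⊆ C → A ⊆ A′ → IsModel F G branch C A → IsModel F G branch C′ A′
  isModel-mono C′⊆C A⊆A′ M = record
    { inside    = λ x∈ v∈ → A⊆A′ (inside M (C′⊆C x∈) v∈)
    ; nonempty  = λ x∈ → nonempty M (C′⊆C x∈)
    ; disjoint  = λ x∈ y∈ → disjoint M (C′⊆C x∈) (C′⊆C y∈)
    ; connected = λ x∈ → connected M (C′⊆C x∈)
    ; edges     = λ x∈ y∈ → edges M (C′⊆C x∈) (C′⊆C y∈)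
    }

  isModel-cong : ∀ {b b′ C A} → (∀ x → b x ≡ b′ x) → IsModel F G b C A → IsModel F G b′ C A
  isModel-cong {b} {b′} eq M = record
    { inside    = λ x∈ v∈ → inside M x∈ (back v∈)
    ; nonempty  = λ {x} x∈ → subst Nonempty (eq x) (nonempty M x∈)
    ; disjoint  = λ x∈ y∈ v∈ w∈ → disjoint M x∈ y∈ (back v∈) (back w∈)
    ; connected = λ {x} x∈ → subst (λ B → ∀ {u v} → u ∈ B → v ∈ B → Walk G (_∈ B) u v) (eq x) (connected M x∈)
    ; edges     = λ {x} {y} x∈ y∈ e → let u , v , u∈ , v∈ , uv = edges M x∈ y∈ e in
                    u , v , subst (u ∈_) (eq x) u∈ , subst (v ∈_) (eq y) v∈ , uv
    }
    where
    back : ∀ {x v} → v ∈ b′ x → v ∈ b x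
    back {x} {v} = subst (v ∈_) (≡-sym (eq x))

  isModel? : ∀ branch C A → Dec (IsModel F G branch C A)
  isModel? b C A = map′
    (λ (i , ne , d , c , e) → record
      { inside    = λ {x} {v} → i x v
      ; nonempty  = λ {x} → ne x
      ; disjoint  = λ {x} {y} {v} → d x y v
      ; connected = λ {x} → c x
      ; edges     = λ {x} {y} → e x y })
    (λ M → (λ x v → inside M) , (λ x → nonempty M) , (λ x y v → disjoint M) ,
           (λ x → connected M) , (λ x y → edges M))
    ( (all? λ x → all? λ v → x ∈? C →-dec v ∈? b x →-dec v ∈? A)
      ×-dec (all? λ x → x ∈? C →-dec nonempty? (b x))
      ×-dec (all? λ x → all? λ y → all? λ v →
               x ∈? C →-dec y ∈? C →-dec v ∈? b x →-dec v ∈? b y →-dec x ≟ y)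
      ×-dec (all? λ x → x ∈? C →-dec connected? G (b x))
      ×-dec (all? λ x → all? λ y → x ∈? C →-dec y ∈? C →-dec edge? F x y →-dec
               any? λ u → any? λ v → u ∈? b x ×-dec v ∈? b y ×-dec edge? G u v))

  model? : ∀ C A → Dec (Model F G C A)
  model? C A = map′
    (λ (Bs , M) → lookup Bs , M)
    (λ (b , M) → tabulate b , isModel-cong (λ x → ≡-sym (lookup∘tabulate b x)) M)
    (anyVec? (n F) λ Bs → isModel? (lookup Bs) C A)

  model-mono : ∀ {C A A′} → A ⊆ A′ → Model F G C A → Model F G C A′
  model-mono A⊆A′ (b , M) = b , isModel-mono id A⊆A′ M

  isModel-∅ : ∀ {b C A} → Empty C → IsModel F G b C A
  isModel-∅ empty = record
    { inside = λ x∈ → ⊥-elim (empty (_ , x∈)) ; nonempty = λ x∈ → ⊥-elim (empty (_ , x∈))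
    ; disjoint = λ x∈ → ⊥-elim (empty (_ , x∈)) ; connected = λ x∈ → ⊥-elim (empty (_ , x∈))
    ; edges = λ x∈ → ⊥-elim (empty (_ , x∈)) }

  ¬model-in-∅ : ∀ {C} → Nonempty C → ¬ Model F G C ⊥
  ¬model-in-∅ (x , x∈C) (b , M) = ∉⊥ (inside M x∈C (proj₂ (nonempty M x∈C)))

  -- A model of a connected subgraph is connected as a whole: `K` spreads inside a branch set by its
  -- connectedness, and to a neighbouring branch set along the edge that the model provides.
  isModel-preserves : ∀ {b C A} {K : V G → Set} → IsModel F G b C A → Connected F C →
    (∀ {u v} → u ∈ A → v ∈ A → Edge G u v → K u → K v) →
    ∀ {x y u v} → x ∈ C → u ∈ b x → K u → y ∈ C → v ∈ b y → K v
  isModel-preserves {b} {C} {A} {K} M conn k {x} {y} x∈C u∈ ku y∈C v∈ =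
    walk-preserves {A = _∈ C} {K = λ z → ∀ {w} → w ∈ b z → K w} across x∈C (conn x∈C y∈C) (within x∈C u∈ ku) v∈
    where
    within : ∀ {z u} → z ∈ C → u ∈ b z → K u → ∀ {w} → w ∈ b z → K w
    within z∈C u∈ ku w∈ =
      walk-preserves (λ p q → k (inside M z∈C p) (inside M z∈C q)) u∈ (connected M z∈C u∈ w∈) ku
    across : ∀ {z z′} → z ∈ C → z′ ∈ C → Edge F z z′ → (∀ {w} → w ∈ b z → K w) → ∀ {w} → w ∈ b z′ → K w
    across z∈C z′∈C e kz w∈ with edges M z∈C z′∈C e
    ... | p , q , p∈ , q∈ , pq = within z′∈C q∈ (k (inside M z∈C p∈) (inside M z′∈C q∈) pq (kz p∈)) w∈

  -- No edge of `F` joins `C` to `W ─ C`, so the two models need no edges between them, and they are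
  -- disjoint because `A` and `B` are.
  model-union : ∀ {C W A B} → Closed F (_∈ W) C → Closed F (_∈ W) (W ─ C) →
    (∀ {v} → v ∈ A → v ∉ B) → Model F G C A → Model F G (W ─ C) B → Model F G W (A ∪ B)
  model-union {C} {W} {A} {B} C-closed W─C-closed A∩B (b , M) (b′ , M′) = b″ , record
    { inside = ins ; nonempty = ne ; disjoint = dis ; connected = con ; edges = eds }
    where
    b″ : V F → Subset (n G)
    b″ x = if does (x ∈? C) then b x else b′ x
    ins : ∀ {x v} → x ∈ W → v ∈ b″ x → v ∈ A ∪ B
    ins {x} x∈W v∈ with x ∈? C
    ... | yes x∈C = p⊆p∪q B (inside M x∈C v∈)
    ... | no x∉C = q⊆p∪q A B (inside M′ (x∈p∧x∉q⇒x∈p─q x∈W x∉C) v∈)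
    ne : ∀ {x} → x ∈ W → Nonempty (b″ x)
    ne {x} x∈W with x ∈? C
    ... | yes x∈C = nonempty M x∈C
    ... | no x∉C = nonempty M′ (x∈p∧x∉q⇒x∈p─q x∈W x∉C)
    dis : ∀ {x y v} → x ∈ W → y ∈ W → v ∈ b″ x → v ∈ b″ y → x ≡ y
    dis {x} {y} x∈W y∈W v∈x v∈y with x ∈? C | y ∈? C
    ... | yes x∈C | yes y∈C = disjoint M x∈C y∈C v∈x v∈y
    ... | yes x∈C | no y∉C = contradiction (inside M′ (x∈p∧x∉q⇒x∈p─q y∈W y∉C) v∈y) (A∩B (inside M x∈C v∈x))
    ... | no x∉C | yes y∈C = contradiction (inside M′ (x∈p∧x∉q⇒x∈p─q x∈W x∉C) v∈x) (A∩B (inside M y∈C v∈y))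
    ... | no x∉C | no y∉C = disjoint M′ (x∈p∧x∉q⇒x∈p─q x∈W x∉C) (x∈p∧x∉q⇒x∈p─q y∈W y∉C) v∈x v∈y
    con : ∀ {x} → x ∈ W → Connected G (b″ x)
    con {x} x∈W with x ∈? C
    ... | yes x∈C = connected M x∈C
    ... | no x∉C = connected M′ (x∈p∧x∉q⇒x∈p─q x∈W x∉C)
    eds : ∀ {x y} → x ∈ W → y ∈ W → Edge F x y → ∃₂ λ u v → u ∈ b″ x × v ∈ b″ y × Edge G u v
    eds {x} {y} x∈W y∈W e with x ∈? C | y ∈? C
    ... | yes x∈C | yes y∈C = edges M x∈C y∈C e
    ... | yes x∈C | no y∉C = contradiction (C-closed x∈C e y∈W) y∉C
    ... | no x∉C | yes y∈C = contradiction y∈C (x∈p─q⇒x∉q W C (W─C-closed (x∈p∧x∉q⇒x∈p─q x∈W x∉C) e y∈W))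
    ... | no x∉C | no y∉C = edges M′ (x∈p∧x∉q⇒x∈p─q x∈W x∉C) (x∈p∧x∉q⇒x∈p─q y∈W y∉C) e

  -- Serves two purposes: for `q` in `P` a branch set is enlarged, for `q` outside `P` a new one is
  -- added.
  isModel-update : ∀ {b P X X′ q B} → IsModel F G b P X → X ⊆ X′ → B ⊆ X′ → Nonempty B → Connected G B →
    (∀ {y v} → y ∈ P → y ≢ q → v ∈ b y → v ∉ B) →
    (∀ {y} → y ∈ P → y ≢ q → Edge F q y → ∃₂ λ u v → u ∈ B × v ∈ b y × Edge G u v) →
    IsModel F G (b [ q ↦ B ]) (P ∪ ⁅ q ⁆) X′
  isModel-update {b} {P} {X} {X′} {q} {B} M X⊆X′ B⊆X′ B-ne B-conn B-dis B-edges = record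
    { inside = ins ; nonempty = ne ; disjoint = dis ; connected = con ; edges = eds }
    where
    old : ∀ {x} → x ∈ P ∪ ⁅ q ⁆ → x ≢ q → x ∈ P
    old = y∈p∪⁅x⁆∧y≢x⇒y∈p P
    ins : ∀ {x v} → x ∈ P ∪ ⁅ q ⁆ → v ∈ (b [ q ↦ B ]) x → v ∈ X′
    ins {x} x∈ v∈ with x ≟ q
    ... | yes _ = B⊆X′ v∈
    ... | no x≢q = X⊆X′ (inside M (old x∈ x≢q) v∈)
    ne : ∀ {x} → x ∈ P ∪ ⁅ q ⁆ → Nonempty ((b [ q ↦ B ]) x)
    ne {x} x∈ with x ≟ q
    ... | yes _ = B-ne
    ... | no x≢q = nonempty M (old x∈ x≢q)
    dis : ∀ {x y v} → x ∈ P ∪ ⁅ q ⁆ → y ∈ P ∪ ⁅ q ⁆ → v ∈ (b [ q ↦ B ]) x → v ∈ (b [ q ↦ B ]) y → x ≡ y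
    dis {x} {y} x∈ y∈ v∈x v∈y with x ≟ q | y ≟ q
    ... | yes x≡q | yes y≡q = trans x≡q (≡-sym y≡q)
    ... | yes x≡q | no y≢q = contradiction v∈x (B-dis (old y∈ y≢q) y≢q v∈y)
    ... | no x≢q | yes y≡q = contradiction v∈y (B-dis (old x∈ x≢q) x≢q v∈x)
    ... | no x≢q | no y≢q = disjoint M (old x∈ x≢q) (old y∈ y≢q) v∈x v∈y
    con : ∀ {x} → x ∈ P ∪ ⁅ q ⁆ → Connected G ((b [ q ↦ B ]) x)
    con {x} x∈ with x ≟ q
    ... | yes _ = B-conn
    ... | no x≢q = connected M (old x∈ x≢q)
    eds : ∀ {x y} → x ∈ P ∪ ⁅ q ⁆ → y ∈ P ∪ ⁅ q ⁆ → Edge F x y →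
      ∃₂ λ u v → u ∈ (b [ q ↦ B ]) x × v ∈ (b [ q ↦ B ]) y × Edge G u v
    eds {x} {y} x∈ y∈ e with x ≟ q | y ≟ q
    ... | yes refl | yes refl = contradiction e (edge-irrefl F)
    ... | yes refl | no y≢q = B-edges (old y∈ y≢q) y≢q e
    ... | no x≢q | no y≢q = edges M (old x∈ x≢q) (old y∈ y≢q) e
    ... | no x≢q | yes refl with B-edges (old x∈ x≢q) x≢q (edge-sym F e)
    ...   | u , v , u∈ , v∈ , uv = v , u , v∈ , u∈ , edge-sym G uv

-- Linkages between boundaries

module _ (F G : Graph) (U : Subset (n G)) where

  Exposed : Subset (n G) → V G → Set
  Exposed Z v = v ∈ Z × ∃ λ u → u ∈ U × u ∉ Z × Edge G v u

  exposed? : ∀ Z → Decidable (Exposed Z)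
  exposed? Z v = v ∈? Z ×-dec any? λ u → u ∈? U ×-dec ¬? (u ∈? Z) ×-dec edge? G v u

  -- The inner vertex boundary, taken relative to `U`.
  ∂ : Subset (n G) → Subset (n G)
  ∂ Z = comprehension (exposed? Z)

  ∂⁺ : ∀ {Z v u} → v ∈ Z → u ∈ U → u ∉ Z → Edge G v u → v ∈ ∂ Z
  ∂⁺ {Z} {v} {u} v∈ u∈ u∉ e = ∈-comprehension⁺ (exposed? Z) (v∈ , u , u∈ , u∉ , e)

  ∂⁻ : ∀ {Z v} → v ∈ ∂ Z → Exposed Z v
  ∂⁻ {Z} = ∈-comprehension⁻ (exposed? Z)

  ∂-∪⁅⁆ : ∀ {X v w} → w ∈ ∂ (X ∪ ⁅ v ⁆) → w ≢ v → w ∈ ∂ X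
  ∂-∪⁅⁆ {X} {v} w∈ w≢v with ∂⁻ w∈
  ... | w∈X∪v , u , u∈U , u∉ , e = ∂⁺ (y∈p∪⁅x⁆∧y≢x⇒y∈p X w∈X∪v w≢v) u∈U (u∉ ∘ p⊆p∪q ⁅ v ⁆) e

  ∂-∪⁅⁆⊆ : ∀ X v → ∂ (X ∪ ⁅ v ⁆) ⊆ ∂ X ∪ ⁅ v ⁆
  ∂-∪⁅⁆⊆ X v {w} w∈ with w ≟ v
  ... | yes refl = x∈p∪⁅x⁆ (∂ X) v
  ... | no w≢v = p⊆p∪q ⁅ v ⁆ (∂-∪⁅⁆ w∈ w≢v)

  -- Disjoint branch sets have distinct roots, so the roots fill `∂ X ─ D` as soon as this set has
  -- at most `∣ P ∣` elements. `D` collects the former roots that a linkage has left behind.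
  record Rooted (P : Subset (n F)) (X D : Subset (n G)) : Set where
    field
      branch      : V F → Subset (n G)
      root        : V F → V G
      isModel     : IsModel F G branch P X
      root∈branch : ∀ {x} → x ∈ P → root x ∈ branch x
      root∈∂      : ∀ {x} → x ∈ P → root x ∈ ∂ X ─ D

  open Rooted
  open IsModel

  -- Menger's theorem for the boundaries of an interval of sets, with the linking paths absorbed
  -- into the branch sets. The vertices in D count as deleted. Moving a root a to a neighbour v
  -- outside X is only harmful if some Z between X ∪ {v} and Y loses an essential boundary
  -- vertex with the deletion of a, but then Z is a tight set that splits the interval.
  link : ∀ N P X Y D → ∣ Y ∣ ≤ N + ∣ X ∣ → X ⊆ Y →
    (∀ Z → X ⊆ Z → Z ⊆ Y → ∣ P ∣ ≤ ∣ ∂ Z ─ D ∣) → ∣ ∂ X ─ D ∣ ≤ ∣ P ∣ → Rooted P X D → Rooted P Y D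
  link N P X Y D ∣Y∣≤ X⊆Y large tight R
    with any? (λ x → x ∈? P ×-dec ¬? (root R x ∈? ∂ Y))
  ... | no none = record
    { branch = branch R ; root = root R ; isModel = isModel-mono id X⊆Y (isModel R)
    ; root∈branch = root∈branch R
    ; root∈∂ = λ {x} x∈P → x∈p∧x∉q⇒x∈p─q
        (decidable-stable (root R x ∈? ∂ Y) λ r∉ → none (x , x∈P , r∉))
        (x∈p─q⇒x∉q (∂ X) D (root∈∂ R x∈P)) }
  ... | yes (x , x∈P , a∉∂Y) with ∂⁻ (p─q⊆p (∂ X) D (root∈∂ R x∈P))
  ...   | a∈X , v , v∈U , v∉X , av = by-fuel N ∣Y∣≤
    where
    a : V G
    a = root R x
    a∈∂X─D : a ∈ ∂ X ─ D
    a∈∂X─D = root∈∂ R x∈P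
    -- As `a` is in `X` but not in `∂ Y`, all its neighbours in `U` lie in `Y`. This applies to `v`,
    -- and later to the vertex showing that `Z` is a proper subset of `Y`.
    neighbour∈Y : ∀ {u} → u ∈ U → Edge G a u → u ∈ Y
    neighbour∈Y {u} u∈U au = decidable-stable (u ∈? Y) λ u∉Y → a∉∂Y (∂⁺ (X⊆Y a∈X) u∈U u∉Y au)
    v∈Y : v ∈ Y
    v∈Y = neighbour∈Y v∈U av
    X⁺ D⁺ : Subset (n G)
    X⁺ = X ∪ ⁅ v ⁆
    D⁺ = D ∪ ⁅ a ⁆
    X⊆X⁺ : X ⊆ X⁺
    X⊆X⁺ = p⊆p∪q ⁅ v ⁆
    v∈X⁺ : v ∈ X⁺
    v∈X⁺ = x∈p∪⁅x⁆ X v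
    ∣X∣<∣X⁺∣ : ∣ X ∣ < ∣ X⁺ ∣
    ∣X∣<∣X⁺∣ = x∉p⇒∣p∣<∣p∪⁅x⁆∣ v∉X
    X⁺⊆Y : X⁺ ⊆ Y
    X⁺⊆Y = ⊆-∪⁅⁆ X⊆Y v∈Y

    ∂Z─D⊆ : ∀ {Z} → ∂ Z ─ D ⊆ (∂ Z ─ D⁺) ∪ ⁅ a ⁆
    ∂Z─D⊆ {Z} {w} w∈ with w ≟ a
    ... | yes refl = x∈p∪⁅x⁆ (∂ Z ─ D⁺) a
    ... | no w≢a = p⊆p∪q ⁅ a ⁆ (x∈p∧x∉q⇒x∈p─q (p─q⊆p (∂ Z) D w∈)
            λ w∈D⁺ → x∈p─q⇒x∉q (∂ Z) D w∈ (y∈p∪⁅x⁆∧y≢x⇒y∈p D w∈D⁺ w≢a))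

    ∂X⁺─D⁺⊆ : ∂ X⁺ ─ D⁺ ⊆ ((∂ X ─ D) - a) ∪ ⁅ v ⁆
    ∂X⁺─D⁺⊆ {w} w∈ with w ≟ v
    ... | yes refl = x∈p∪⁅x⁆ ((∂ X ─ D) - a) v
    ... | no w≢v = p⊆p∪q ⁅ v ⁆ (x∈p∧x≢y⇒x∈p-y
            (x∈p∧x∉q⇒x∈p─q (∂-∪⁅⁆ (p─q⊆p (∂ X⁺) D⁺ w∈) w≢v) (w∉D⁺ ∘ p⊆p∪q ⁅ a ⁆))
            λ { refl → w∉D⁺ (x∈p∪⁅x⁆ D a) })
      where
      w∉D⁺ : w ∉ D⁺
      w∉D⁺ = x∈p─q⇒x∉q (∂ X⁺) D⁺ w∈

    new-size : ∣ ((∂ X ─ D) - a) ∪ ⁅ v ⁆ ∣ ≤ ∣ P ∣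
    new-size = ≤-trans (∣p∪⁅x⁆∣≤1+∣p∣ ((∂ X ─ D) - a) v) (≤-trans (x∈p⇒∣p-x∣<∣p∣ a∈∂X─D) tight)

    advance : ∣ P ∣ ≤ ∣ ∂ X⁺ ─ D⁺ ∣ → Rooted P X⁺ D⁺
    advance large⁺ = record
      { branch = branch R [ x ↦ B ] ; root = root R [ x ↦ v ]
      ; isModel = isModel-mono (p⊆p∪q ⁅ x ⁆) id (isModel-update M X⊆X⁺ B⊆X⁺ (v , x∈p∪⁅x⁆ (branch R x) v)
          (connected-∪⁅⁆ (connected M x∈P) (root∈branch R x∈P) av) B-disjoint B-edges)
      ; root∈branch = root∈branch⁺ ; root∈∂ = root∈∂⁺ }
      where
      M : IsModel F G (branch R) P X
      M = isModel R
      B : Subset (n G)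
      B = branch R x ∪ ⁅ v ⁆
      B⊆X⁺ : B ⊆ X⁺
      B⊆X⁺ = ⊆-∪⁅⁆ (X⊆X⁺ ∘ inside M x∈P) v∈X⁺
      B-disjoint : ∀ {y w} → y ∈ P → y ≢ x → w ∈ branch R y → w ∉ B
      B-disjoint y∈P y≢x w∈ w∈B = y≢x (disjoint M y∈P x∈P w∈
        (y∈p∪⁅x⁆∧y≢x⇒y∈p (branch R x) w∈B λ { refl → v∉X (inside M y∈P w∈) }))
      B-edges : ∀ {y} → y ∈ P → y ≢ x → Edge F x y → ∃₂ λ s t → s ∈ B × t ∈ branch R y × Edge G s t
      B-edges y∈P _ e with edges M x∈P y∈P e
      ... | s , t , s∈ , t∈ , st = s , t , p⊆p∪q ⁅ v ⁆ s∈ , t∈ , st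
      root∈branch⁺ : ∀ {y} → y ∈ P → (root R [ x ↦ v ]) y ∈ (branch R [ x ↦ B ]) y
      root∈branch⁺ {y} y∈P with y ≟ x
      ... | yes _ = x∈p∪⁅x⁆ (branch R x) v
      ... | no _ = root∈branch R y∈P
      -- The right-hand side of `∂X⁺─D⁺⊆` has at most `∣ P ∣` elements and its left-hand side at
      -- least as many, so the two sets coincide: `v` and all other roots are on the new boundary.
      all-exposed : ((∂ X ─ D) - a) ∪ ⁅ v ⁆ ⊆ ∂ X⁺ ─ D⁺
      all-exposed = p⊆q∧∣q∣≤∣p∣⇒q⊆p ∂X⁺─D⁺⊆ (≤-trans new-size large⁺)
      root∈∂⁺ : ∀ {y} → y ∈ P → (root R [ x ↦ v ]) y ∈ ∂ X⁺ ─ D⁺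
      root∈∂⁺ {y} y∈P with y ≟ x
      ... | yes _ = all-exposed (x∈p∪⁅x⁆ ((∂ X ─ D) - a) v)
      ... | no y≢x = all-exposed (p⊆p∪q ⁅ v ⁆ (x∈p∧x≢y⇒x∈p-y (root∈∂ R y∈P)
              λ eq → y≢x (disjoint M y∈P x∈P (root∈branch R y∈P)
                (subst (_∈ branch R x) (≡-sym eq) (root∈branch R x∈P)))))

    by-fuel : ∀ N → ∣ Y ∣ ≤ N + ∣ X ∣ → Rooted P Y D
    by-fuel zero ∣Y∣≤ = contradiction (≤-trans (p⊆q⇒∣p∣≤∣q∣ {p = X⁺} {q = Y} X⁺⊆Y) ∣Y∣≤) (<⇒≱ ∣X∣<∣X⁺∣)
    by-fuel (suc N) ∣Y∣≤
      with anySubset? (λ Z → X⁺ ⊆? Z ×-dec Z ⊆? Y ×-dec suc ∣ ∂ Z ─ D⁺ ∣ ≤? ∣ P ∣)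
    ... | yes (Z , X⁺⊆Z , Z⊆Y , small) =
      link N P Z Y D ∣Y∣≤N+∣Z∣ Z⊆Y (λ Z′ Z⊆Z′ → large Z′ (Z⊆Z′ ∘ X⊆Z)) Z-tight
        (link N P X Z D ∣Z∣≤N+∣X∣ X⊆Z (λ Z′ X⊆Z′ Z′⊆Z → large Z′ X⊆Z′ (Z⊆Y ∘ Z′⊆Z)) tight R)
      where
      X⊆Z : X ⊆ Z
      X⊆Z = X⁺⊆Z ∘ X⊆X⁺
      ∣Y∣≤N+∣Z∣ : ∣ Y ∣ ≤ N + ∣ Z ∣
      ∣Y∣≤N+∣Z∣ = spend ∣Y∣≤ (≤-trans ∣X∣<∣X⁺∣ (p⊆q⇒∣p∣≤∣q∣ {p = X⁺} {q = Z} X⁺⊆Z))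
      Z-tight : ∣ ∂ Z ─ D ∣ ≤ ∣ P ∣
      Z-tight = ≤-trans (p⊆q⇒∣p∣≤∣q∣ {p = ∂ Z ─ D} {q = (∂ Z ─ D⁺) ∪ ⁅ a ⁆} (∂Z─D⊆ {Z})) (≤-trans (∣p∪⁅x⁆∣≤1+∣p∣ (∂ Z ─ D⁺) a) small)
      -- Only the deletion of `a` can bring the boundary of `Z` below `∣ P ∣`. So `a` has a
      -- neighbour in `Y` outside `Z`, and the interval from `X` to `Z` is shorter; the one from `Z`
      -- to `Y` is shorter because `v` is in `Z`.
      a∈∂Z : a ∈ ∂ Z
      a∈∂Z = decidable-stable (a ∈? ∂ Z) λ a∉∂Z → <⇒≱ small (≤-trans (large Z X⊆Z Z⊆Y)
        (p⊆q⇒∣p∣≤∣q∣ {p = ∂ Z ─ D} {q = ∂ Z ─ D⁺} λ w∈ → y∈p∪⁅x⁆∧y≢x⇒y∈p (∂ Z ─ D⁺) (∂Z─D⊆ {Z} w∈)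
          λ { refl → a∉∂Z (p─q⊆p (∂ Z) D w∈) }))
      ∣Z∣≤N+∣X∣ : ∣ Z ∣ ≤ N + ∣ X ∣
      ∣Z∣≤N+∣X∣ with ∂⁻ a∈∂Z
      ... | _ , u , u∈U , u∉Z , au =
        s≤s⁻¹ (≤-trans (p⊂q⇒∣p∣<∣q∣ (Z⊆Y , u , neighbour∈Y u∈U au , u∉Z)) ∣Y∣≤)
    ... | no none = record
      { branch = branch R⁺ ; root = root R⁺ ; isModel = isModel R⁺ ; root∈branch = root∈branch R⁺
      ; root∈∂ = λ y∈P → x∈p∧x∉q⇒x∈p─q (p─q⊆p (∂ Y) D⁺ (root∈∂ R⁺ y∈P))
          (x∈p─q⇒x∉q (∂ Y) D⁺ (root∈∂ R⁺ y∈P) ∘ p⊆p∪q ⁅ a ⁆) }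
      where
      large⁺ : ∀ Z → X⁺ ⊆ Z → Z ⊆ Y → ∣ P ∣ ≤ ∣ ∂ Z ─ D⁺ ∣
      large⁺ Z X⁺⊆Z Z⊆Y = ≮⇒≥ λ small → none (Z , X⁺⊆Z , Z⊆Y , small)
      R⁺ : Rooted P Y D⁺
      R⁺ = link N P X⁺ Y D⁺
        (spend ∣Y∣≤ ∣X∣<∣X⁺∣)
        X⁺⊆Y large⁺ (≤-trans (p⊆q⇒∣p∣≤∣q∣ {p = ∂ X⁺ ─ D⁺} {q = ((∂ X ─ D) - a) ∪ ⁅ v ⁆} ∂X⁺─D⁺⊆) new-size) (advance (large⁺ X⁺ id X⁺⊆Y))

  -- Small separations from maximal sets

  module _ (forest : IsForest F) {C : Subset (n F)} (C-nonempty : Nonempty C) (C-connected : Connected F C)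
           {Q : Subset (n G) → Set} (Q? : Decidable Q) (Q-mono : ∀ {A B} → A ⊆ B → Q A → Q B)
           (¬Q⊥ : ¬ Q ⊥) (model⇒Q : ∀ {A} → Model F G C A → Q A) where

    -- `Q` will say that some tree of the current list has a model in the set. The argument only
    -- uses that `Q` is decidable, monotone, false on the empty set and implied by a model of `C`.
    Good : Subset (n G) → Set
    Good X = X ⊆ U × ∣ ∂ X ∣ ≤ ∣ C ∣ × ¬ Q X

    Maximal : Subset (n G) → Set
    Maximal X = ∀ Y → Good Y → X ⊆ Y → ∣ ∂ Y ∣ ≤ ∣ ∂ X ∣ → Y ⊆ X

    maximal-above : ∀ N X → n G ≤ N + ∣ X ∣ → Good X →
      ∃ λ Y → X ⊆ Y × ∣ ∂ Y ∣ ≤ ∣ ∂ X ∣ × Good Y × Maximal Y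
    maximal-above N X bound good
      with anySubset? (λ Y → (Y ⊆? U ×-dec ∣ ∂ Y ∣ ≤? ∣ C ∣ ×-dec ¬? (Q? Y)) ×-dec
             X ⊆? Y ×-dec ∣ ∂ Y ∣ ≤? ∣ ∂ X ∣ ×-dec any? λ v → v ∈? Y ×-dec ¬? (v ∈? X))
    ... | no none = X , id , ≤-refl , good , λ Y goodY X⊆Y small {v} v∈Y →
            decidable-stable (v ∈? X) λ v∉X → none (Y , goodY , X⊆Y , small , v , v∈Y , v∉X)
    maximal-above zero X bound good | yes (Y , goodY , X⊆Y , small , v , v∈Y , v∉X) =
      contradiction (≤-trans (∣p∣≤n Y) bound) (<⇒≱ (p⊂q⇒∣p∣<∣q∣ (X⊆Y , v , v∈Y , v∉X)))
    maximal-above (suc N) X bound good | yes (Y , goodY , X⊆Y , small , v , v∈Y , v∉X)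
      with maximal-above N Y (spend bound (p⊂q⇒∣p∣<∣q∣ (X⊆Y , v , v∈Y , v∉X))) goodY
    ... | Z , Y⊆Z , smaller , goodZ , maxZ = Z , Y⊆Z ∘ X⊆Y , ≤-trans smaller small , goodZ , maxZ

    -- The invariant of the growth. By `∂≤` and `≤∂` the roots are in bijection with the boundary of
    -- `X`.
    record Stage (P : Subset (n F)) (X : Subset (n G)) : Set where
      field
        placed  : P ⊆ C
        conn    : Connected F P
        good    : Good X
        maximal : Maximal X
        ∂≤      : ∣ ∂ X ∣ ≤ ∣ P ∣
        ≤∂      : ∣ P ∣ ≤ ∣ ∂ X ∣
        rooted  : Rooted P X ⊥

    open Stage

    -- The assumption that the desired separation does not exist, to be refuted when `Q U` holds.
    module _ (uncut : ∀ A S → A ⊆ U → ∂ A ⊆ S → ∣ S ∣ ≤ ∣ C ∣ → Q A → Q (A ─ S)) where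

      -- The set `∂ X ∪ ⁅ v ⁆` is small enough for `uncut` and contains the new boundary. If `Q`
      -- held on the enlarged set, it would survive the removal of this separator, but what remains
      -- lies in `X`, where `Q` fails.
      good-∪⁅⁆ : ∀ {X v} → Good X → ∣ ∂ X ∣ < ∣ C ∣ → v ∈ U → Good (X ∪ ⁅ v ⁆)
      good-∪⁅⁆ {X} {v} (X⊆U , _ , ¬QX) small v∈U =
        X⁺⊆U , ≤-trans (p⊆q⇒∣p∣≤∣q∣ (∂-∪⁅⁆⊆ X v)) ∣S∣≤ ,
        λ QX⁺ → ¬QX (Q-mono X⁺─S⊆X (uncut (X ∪ ⁅ v ⁆) S X⁺⊆U (∂-∪⁅⁆⊆ X v) ∣S∣≤ QX⁺))
        where
        S : Subset (n G)
        S = ∂ X ∪ ⁅ v ⁆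
        X⁺⊆U : X ∪ ⁅ v ⁆ ⊆ U
        X⁺⊆U = ⊆-∪⁅⁆ X⊆U v∈U
        ∣S∣≤ : ∣ S ∣ ≤ ∣ C ∣
        ∣S∣≤ = ≤-trans (∣p∪⁅x⁆∣≤1+∣p∣ (∂ X) v) small
        X⁺─S⊆X : X ∪ ⁅ v ⁆ ─ S ⊆ X
        X⁺─S⊆X {w} w∈ = y∈p∪⁅x⁆∧y≢x⇒y∈p X (p─q⊆p (X ∪ ⁅ v ⁆) S w∈)
          λ { refl → x∈p─q⇒x∉q (X ∪ ⁅ v ⁆) S w∈ (x∈p∪⁅x⁆ (∂ X) v) }

      -- The vertex `q` gets the branch set `⁅ v ⁆`. Passing to a maximal set above `X ∪ ⁅ v ⁆`
      -- restores the invariant, and `link` carries the roots to its boundary.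
      place : ∀ {P X q v} (s : Stage P X) → q ∈ C → q ∉ P → v ∈ U → v ∉ X → Connected F (P ∪ ⁅ q ⁆) →
        (∀ {y} → y ∈ P → Edge F q y → Edge G v (root (rooted s) y)) → ∃ (Stage (P ∪ ⁅ q ⁆))
      place {P} {X} {q} {v} s q∈C q∉P v∈U v∉X P⁺-conn attached
        with maximal-above (n G) (X ∪ ⁅ v ⁆) (m≤m+n (n G) _)
               (good-∪⁅⁆ (good s) (≤-<-trans (∂≤ s) (p⊂q⇒∣p∣<∣q∣ (placed s , q , q∈C , q∉P))) v∈U)
      ... | Y , X⁺⊆Y , ∂Y≤∂X⁺ , good-Y@(Y⊆U , _ , ¬QY) , max-Y = Y , record
        { placed = ⊆-∪⁅⁆ (placed s) q∈C ; conn = P⁺-conn ; good = good-Y ; maximal = max-Y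
        ; ∂≤ = ≤-trans ∂Y≤∂X⁺ ∂X⁺≤ ; ≤∂ = large Y X⁺⊆Y id
        ; rooted = link (n G) P⁺ X⁺ Y ⊥ (≤-trans (∣p∣≤n Y) (m≤m+n (n G) _)) X⁺⊆Y
            (λ Z X⁺⊆Z Z⊆Y → subst (λ B → ∣ P⁺ ∣ ≤ ∣ B ∣) (≡-sym (p─⊥≡p (∂ Z))) (large Z X⁺⊆Z Z⊆Y))
            (subst (λ B → ∣ B ∣ ≤ ∣ P⁺ ∣) (≡-sym (p─⊥≡p (∂ X⁺))) ∂X⁺≤)
            rooted⁺ }
        where
        R : Rooted P X ⊥
        R = rooted s
        M : IsModel F G (branch R) P X
        M = isModel R
        P⁺ : Subset (n F)
        P⁺ = P ∪ ⁅ q ⁆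
        X⁺ : Subset (n G)
        X⁺ = X ∪ ⁅ v ⁆
        ∣∂X∪v∣≤ : ∣ ∂ X ∪ ⁅ v ⁆ ∣ ≤ ∣ P⁺ ∣
        ∣∂X∪v∣≤ = ≤-trans (∣p∪⁅x⁆∣≤1+∣p∣ (∂ X) v) (≤-trans (s≤s (∂≤ s)) (x∉p⇒∣p∣<∣p∪⁅x⁆∣ q∉P))
        ∂X⁺≤ : ∣ ∂ X⁺ ∣ ≤ ∣ P⁺ ∣
        ∂X⁺≤ = ≤-trans (p⊆q⇒∣p∣≤∣q∣ {p = ∂ X⁺} {q = ∂ X ∪ ⁅ v ⁆} (∂-∪⁅⁆⊆ X v)) ∣∂X∪v∣≤
        large : ∀ Z → X⁺ ⊆ Z → Z ⊆ Y → ∣ P⁺ ∣ ≤ ∣ ∂ Z ∣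
        -- A set `Z` with at most `∣ P ∣` boundary vertices would be good and contain `v`, against
        -- the maximality of `X`.
        large Z X⁺⊆Z Z⊆Y = ≤-trans (∣p∪⁅x⁆∣≤1+∣p∣ P q) (≰⇒> λ ∂Z≤ → v∉X (maximal s Z
          (Y⊆U ∘ Z⊆Y , ≤-trans ∂Z≤ (p⊆q⇒∣p∣≤∣q∣ (placed s)) , ¬QY ∘ Q-mono Z⊆Y)
          (X⁺⊆Z ∘ p⊆p∪q ⁅ v ⁆) (≤-trans ∂Z≤ (≤∂ s)) (X⁺⊆Z (x∈p∪⁅x⁆ X v))))
        all-exposed : ∂ X ∪ ⁅ v ⁆ ⊆ ∂ X⁺ ─ ⊥
        all-exposed w∈ = x∈p∧x∉q⇒x∈p─q
          (p⊆q∧∣q∣≤∣p∣⇒q⊆p {p = ∂ X⁺} {q = ∂ X ∪ ⁅ v ⁆} (∂-∪⁅⁆⊆ X v) (≤-trans ∣∂X∪v∣≤ (large X⁺ id X⁺⊆Y)) w∈) ∉⊥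
        rooted⁺ : Rooted P⁺ X⁺ ⊥
        rooted⁺ = record
          { branch = branch R [ q ↦ ⁅ v ⁆ ] ; root = root R [ q ↦ v ]
          ; isModel = isModel-update M (p⊆p∪q ⁅ v ⁆) (q⊆p∪q X ⁅ v ⁆) (v , x∈⁅x⁆ v) (connected-⁅⁆ v)
              (λ y∈P _ w∈ w∈v → v∉X (subst (_∈ X) (x∈⁅y⁆⇒x≡y v w∈v) (inside M y∈P w∈)))
              (λ {y} y∈P _ e → v , root R y , x∈⁅x⁆ v , root∈branch R y∈P , attached y∈P e)
          ; root∈branch = root∈branch⁺ ; root∈∂ = root∈∂⁺ }
          where
          root∈branch⁺ : ∀ {y} → y ∈ P⁺ → (root R [ q ↦ v ]) y ∈ (branch R [ q ↦ ⁅ v ⁆ ]) y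
          root∈branch⁺ {y} y∈ with y ≟ q
          ... | yes _ = x∈⁅x⁆ v
          ... | no y≢q = root∈branch R (y∈p∪⁅x⁆∧y≢x⇒y∈p P y∈ y≢q)
          root∈∂⁺ : ∀ {y} → y ∈ P⁺ → (root R [ q ↦ v ]) y ∈ ∂ X⁺ ─ ⊥
          root∈∂⁺ {y} y∈ with y ≟ q
          ... | yes _ = all-exposed (x∈p∪⁅x⁆ (∂ X) v)
          ... | no y≢q = all-exposed (p⊆p∪q ⁅ v ⁆ (p─q⊆p (∂ X) ⊥ (root∈∂ R (y∈p∪⁅x⁆∧y≢x⇒y∈p P y∈ y≢q))))

      -- Every round places one more vertex of `C`. Once all are placed, there is a model of `C` in
      -- `X`, although `Q` fails on `X`.
      grow : ∀ N {P X} → ∣ C ∣ ≤ N + ∣ P ∣ → Nonempty P → ¬ Stage P X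
      grow N {P} {X} bound P-ne s with any? (λ x → x ∈? C ×-dec ¬? (x ∈? P))
      ... | no none = proj₂ (proj₂ (good s)) (model⇒Q (branch (rooted s) , isModel-mono
              (λ {x} x∈C → decidable-stable (x ∈? P) λ x∉P → none (x , x∈C , x∉P)) id (isModel (rooted s))))
      grow zero bound P-ne s | yes (x , x∈C , x∉P) =
        <⇒≱ (p⊂q⇒∣p∣<∣q∣ (placed s , x , x∈C , x∉P)) bound
      grow (suc N) {P} {X} bound P-ne s | yes (x , x∈C , x∉P)
        with connected-exit C-connected P-ne (placed s) x∈C x∉P
      -- The root of `p` is on the boundary, so it has a neighbour `v` in `U` outside `X`, which is
      -- free for `q`. In a forest `p` is the only placed neighbour of `q`, so this one adjacency
      -- suffices.
      ... | p , q , p∈P , q∈C , q∉P , pq with ∂⁻ (p─q⊆p (∂ X) ⊥ (root∈∂ (rooted s) p∈P))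
      ...   | _ , v , v∈U , v∉X , rv =
        grow N (spend bound (x∉p⇒∣p∣<∣p∪⁅x⁆∣ q∉P)) (q , x∈p∪⁅x⁆ P q) (proj₂
          (place s q∈C q∉P v∈U v∉X (connected-∪⁅⁆ (conn s) p∈P pq) (λ {y} y∈P qy →
               subst (λ z → Edge G v (root (rooted s) z))
                 (forest-unique-neighbour forest (conn s) q∉P p∈P y∈P (edge-sym F pq) qy) (edge-sym G rv))))

      ∣∂⊥∣≡0 : ∣ ∂ ⊥ ∣ ≡ 0
      ∣∂⊥∣≡0 = trans (cong ∣_∣ (Empty-unique λ (v , v∈) → ∉⊥ (proj₁ (∂⁻ v∈)))) (∣⊥∣≡0 (n G))

      -- The vertex `v` is a default value for the total function `root`.
      empty-stage : ∀ {X} → V G → ∣ ∂ X ∣ ≤ ∣ ∂ ⊥ ∣ → Good X → Maximal X → Stage ⊥ X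
      empty-stage {X} v ∂X≤ good-X max-X = record
        { placed = ⊥-elim ∘ ∉⊥ ; conn = ⊥-elim ∘ ∉⊥ ; good = good-X ; maximal = max-X
        ; ∂≤ = ≤-trans ∂X≤ (subst (_≤ ∣ ⊥ {n F} ∣) (≡-sym ∣∂⊥∣≡0) z≤n)
        ; ≤∂ = subst (_≤ ∣ ∂ X ∣) (≡-sym (∣⊥∣≡0 (n F))) z≤n
        ; rooted = record
            { branch = λ _ → ⊥ ; root = λ _ → v ; isModel = isModel-∅ λ (_ , x∈) → ∉⊥ x∈
            ; root∈branch = ⊥-elim ∘ ∉⊥ ; root∈∂ = ⊥-elim ∘ ∉⊥ } }

      uncut⇒¬Q : ¬ Q U
      uncut⇒¬Q QU
        with maximal-above (n G) ⊥ (m≤m+n (n G) _)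
               (⊥-elim ∘ ∉⊥ , subst (_≤ ∣ C ∣) (≡-sym ∣∂⊥∣≡0) z≤n , ¬Q⊥)
      ... | X , _ , ∂X≤0 , good-X@(X⊆U , _ , ¬QX) , max-X with any? (λ v → v ∈? U ×-dec ¬? (v ∈? X))
      ...   | no none = ¬QX (Q-mono (λ {v} v∈U → decidable-stable (v ∈? X) λ v∉X → none (v , v∈U , v∉X)) QU)
      ...   | yes (v , v∈U , v∉X) =
        grow ∣ C ∣ (m≤m+n ∣ C ∣ _) (q , x∈p∪⁅x⁆ ⊥ q) (proj₂
          (place (empty-stage v ∂X≤0 good-X max-X) (proj₂ C-nonempty) ∉⊥ v∈U v∉X
            (subst (λ P → ∀ {x y} → x ∈ P → y ∈ P → Walk F (_∈ P) x y) (≡-sym (∪-identityˡ ⁅ q ⁆)) (connected-⁅⁆ q))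
            (⊥-elim ∘ ∉⊥)))
        where
        q : V F
        q = proj₁ C-nonempty

    -- All pairs `A`, `S` are searched; a failed search is exactly the hypothesis `uncut`.
    separation : Q U → ∃₂ λ A S → A ⊆ U × ∂ A ⊆ S × ∣ S ∣ ≤ ∣ C ∣ × Q A × ¬ Q (A ─ S)
    separation QU with anySubset? (λ A → anySubset? λ S →
      A ⊆? U ×-dec ∂ A ⊆? S ×-dec ∣ S ∣ ≤? ∣ C ∣ ×-dec Q? A ×-dec ¬? (Q? (A ─ S)))
    ... | yes cut = cut
    ... | no none = contradiction QU (uncut⇒¬Q λ A S A⊆U ∂A⊆S ∣S∣≤ QA →
            decidable-stable (Q? (A ─ S)) λ ¬QA─S → none (A , S , A⊆U , ∂A⊆S , ∣S∣≤ , QA , ¬QA─S))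

-- Packings

-- Removal at a position, since the list may contain equal trees several times.
data Select {T : Set} (x : T) : List T → List T → Set where
  here  : ∀ {xs} → Select x (x ∷ xs) xs
  there : ∀ {y xs ys} → Select x xs ys → Select x (y ∷ xs) (y ∷ ys)

module _ {T : Set} where

  select-any : ∀ {P : T → Set} {xs} → Any P xs → ∃₂ λ x ys → P x × Select x xs ys
  select-any (here px) = _ , _ , px , here
  select-any (there any) with select-any any
  ... | x , ys , px , sel = x , _ ∷ ys , px , there sel

  select-length : ∀ {x : T} {xs ys} → Select x xs ys → length xs ≡ suc (length ys)
  select-length here = refl
  select-length (there sel) = cong suc (select-length sel)

  select-∈ : ∀ {x : T} {xs ys y} → Select x xs ys → y ∈ˡ xs → y ≡ x ⊎ y ∈ˡ ys
  select-∈ here (here eq) = inj₁ eq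
  select-∈ here (there y∈) = inj₂ y∈
  select-∈ (there sel) (here eq) = inj₂ (here eq)
  select-∈ (there sel) (there y∈) = Sum.map₂ there (select-∈ sel y∈)

  select-∈-self : ∀ {x : T} {xs ys} → Select x xs ys → x ∈ˡ xs
  select-∈-self here = here refl
  select-∈-self (there sel) = there (select-∈-self sel)

  select-⊆ : ∀ {x : T} {xs ys y} → Select x xs ys → y ∈ˡ ys → y ∈ˡ xs
  select-⊆ here y∈ = there y∈
  select-⊆ (there sel) (here eq) = here eq
  select-⊆ (there sel) (there y∈) = there (select-⊆ sel y∈)

size : ∀ {N} → List (Subset N) → ℕ
size L = sum (map ∣_∣ L)

∈⇒∣∣≤size : ∀ {N} {C : Subset N} {L} → C ∈ˡ L → ∣ C ∣ ≤ size L
∈⇒∣∣≤size (here refl) = m≤m+n _ _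
∈⇒∣∣≤size {L = D ∷ _} (there C∈L) = ≤-trans (∈⇒∣∣≤size C∈L) (m≤n+m _ ∣ D ∣)

select-size : ∀ {N} {C : Subset N} {L L′} → Select C L L′ → size L ≡ ∣ C ∣ + size L′
select-size here = refl
select-size {C = C} (there {D} {ys = L′} sel) = trans (cong (∣ D ∣ +_) (select-size sel))
  (trans (≡-sym (+-assoc ∣ D ∣ ∣ C ∣ (size L′)))
    (trans (cong (_+ size L′) (+-comm ∣ D ∣ ∣ C ∣)) (+-assoc ∣ C ∣ ∣ D ∣ (size L′))))

module _ (F G : Graph) where

  -- Disjointness is expressed by deleting each used set before the remaining trees are packed.
  data Packing : List (Subset (n F)) → Subset (n G) → Set where
    []   : ∀ {A} → Packing [] A
    pack : ∀ {C L A} B → B ⊆ A → Model F G C B → Packing L (A ─ B) → Packing (C ∷ L) A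

  -- The tree packed first may stand anywhere in the list; this is harmless because two disjoint
  -- sets can be deleted in either order.
  insert : ∀ {C L L′ A B} → Select C L L′ → B ⊆ A → Model F G C B → Packing L′ (A ─ B) → Packing L A
  insert here B⊆A M packing = pack _ B⊆A M packing
  insert {A = A} {B} (there sel) B⊆A M (pack {L = L′} B′ B′⊆ M′ packing) =
    pack B′ (p─q⊆p A B ∘ B′⊆) M′ (insert sel
      (λ v∈B → x∈p∧x∉q⇒x∈p─q (B⊆A v∈B) λ v∈B′ → x∈p─q⇒x∉q A B (B′⊆ v∈B′) v∈B)
      M (subst (Packing L′) (p─q─r≡p─r─q A B B′) packing))

  Tree : Subset (n F) → Set
  Tree C = Nonempty C × Connected F C

  -- A model that avoids `S` contains no vertex of `∂ A`, so none of its edges leaves `A`; being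
  -- connected, it lies on one side of the separation.
  model-splits : ∀ {U A S X C} → Tree C → ∂ F G U A ⊆ S → Model F G C (U ─ (S ∪ X)) →
    Model F G C (A ─ S) ⊎ Model F G C ((U ─ A) ─ X)
  model-splits {U} {A} {S} {X} {C} ((x , x∈C) , C-conn) ∂A⊆S (b , M) = cases (nonempty x∈C)
    where
    open IsModel M
    W : Subset (n G)
    W = U ─ (S ∪ X)
    W⊆U : W ⊆ U
    W⊆U = p─q⊆p U (S ∪ X)
    ∉S : ∀ {v} → v ∈ W → v ∉ S
    ∉S v∈W v∈S = x∈p─q⇒x∉q U (S ∪ X) v∈W (p⊆p∪q X v∈S)
    ∉X : ∀ {v} → v ∈ W → v ∉ X
    ∉X v∈W v∈X = x∈p─q⇒x∉q U (S ∪ X) v∈W (q⊆p∪q S X v∈X)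
    stays : ∀ {u v} → u ∈ W → v ∈ W → Edge G u v → u ∈ A → v ∈ A
    stays {v = v} u∈W v∈W uv u∈A = decidable-stable (v ∈? A) λ v∉A →
      ∉S u∈W (∂A⊆S (∂⁺ F G U u∈A (W⊆U v∈W) v∉A uv))
    relocate : ∀ {B} → (∀ {y v} → y ∈ C → v ∈ b y → v ∈ B) → Model F G C B
    relocate ins = b , record { inside = ins ; nonempty = nonempty ; disjoint = disjoint
                              ; connected = connected ; edges = edges }
    cases : Nonempty (b x) → Model F G C (A ─ S) ⊎ Model F G C ((U ─ A) ─ X)
    cases (u , u∈) with u ∈? A
    ... | yes u∈A = inj₁ (relocate λ y∈C v∈ → x∈p∧x∉q⇒x∈p─q
            (isModel-preserves M C-conn stays x∈C u∈ u∈A y∈C v∈) (∉S (inside y∈C v∈)))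
    ... | no u∉A = inj₂ (relocate λ y∈C v∈ → x∈p∧x∉q⇒x∈p─q (x∈p∧x∉q⇒x∈p─q (W⊆U (inside y∈C v∈))
            (isModel-preserves {K = _∉ A} M C-conn
              (λ p∈W q∈W pq p∉A q∈A → p∉A (stays q∈W p∈W (edge-sym G pq) q∈A)) x∈C u∈ u∉A y∈C v∈))
            (∉X (inside y∈C v∈)))

  -- Packing or hitting a list of trees

  smallest : ∀ C (L : List (Subset (n F))) → ∃ λ M → M ∈ˡ (C ∷ L) × All (λ D → ∣ M ∣ ≤ ∣ D ∣) (C ∷ L)
  smallest C L = argmin ∣_∣ C L , [ here , there ]′ (argmin-sel ∣_∣ C L) ,
    f[argmin]≤f[⊤] {f = ∣_∣} C L ∷ f[argmin]≤f[xs] {f = ∣_∣} C L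

  -- The bound is required for every `M` in the list, in particular for a largest one, and is
  -- written as a sum to avoid truncated subtraction.
  Hit : List (Subset (n F)) → Subset (n G) → Set
  Hit L U = ∃ λ X → (∀ {M} → M ∈ˡ L → ∣ X ∣ + ∣ M ∣ ≤ size L) × Any (λ T → ¬ Model F G T (U ─ X)) L

  pack-or-hit : IsForest F → ∀ N L → length L ≡ N → All Tree L → ∀ U → Packing L U ⊎ Hit L U
  pack-or-hit forest N [] eq trees U = inj₁ []
  pack-or-hit forest (suc N) L@(D ∷ L₀) eq trees U with Any.any? (λ T → model? {F} {G} T U) L
  ... | no none = inj₂ (⊥ , ⊥-bound , here λ M → none (here (model-mono (p─q⊆p U ⊥) M)))
    where
    ⊥-bound : ∀ {M} → M ∈ˡ L → ∣ ⊥ {n G} ∣ + ∣ M ∣ ≤ size L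
    ⊥-bound {M} M∈L = subst (λ c → c + ∣ M ∣ ≤ size L) (≡-sym (∣⊥∣≡0 (n G))) (∈⇒∣∣≤size M∈L)
  ... | yes found with smallest D L₀
  ... | C , C∈L , C-min
    -- The smallest tree `C` bounds the separator, while the tree found in `A` may be a different
    -- member of the list.
    with separation F G U forest (proj₁ (All.lookup trees C∈L)) (proj₂ (All.lookup trees C∈L))
           {Q = λ A → Any (λ T → Model F G T A) L} (λ A → Any.any? (λ T → model? T A) L)
           (λ A⊆B → Any.map (model-mono A⊆B))
           (λ any → let T , T∈L , M = find any in ¬model-in-∅ (proj₁ (All.lookup trees T∈L)) M)
           (λ M → Any.map (λ { refl → M }) C∈L) found
  ... | A , S , A⊆U , ∂A⊆S , ∣S∣≤∣C∣ , QA , ¬Q with select-any QA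
  ... | T , L′ , M , sel
    with pack-or-hit forest N L′ (cong Data.Nat.pred (trans (≡-sym (select-length sel)) eq))
           (All.tabulate λ D∈ → All.lookup trees (select-⊆ sel D∈)) (U ─ A)
  ... | inj₁ packing = inj₁ (insert sel A⊆U M packing)
  ... | inj₂ (X , bound , hit) = inj₂ (S ∪ X , bound⁺ , hit⁺)
    where
    ∣S∣≤ : ∀ {D} → D ∈ˡ L → ∣ S ∣ ≤ ∣ D ∣
    ∣S∣≤ D∈L = ≤-trans ∣S∣≤∣C∣ (All.lookup C-min D∈L)
    T≤ : ∣ S ∣ ≤ ∣ T ∣
    T≤ = ∣S∣≤ (select-∈-self sel)
    bound⁺ : ∀ {D} → D ∈ˡ L → ∣ S ∪ X ∣ + ∣ D ∣ ≤ size L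
    bound⁺ {D} D∈L = subst (∣ S ∪ X ∣ + ∣ D ∣ ≤_) (≡-sym (select-size sel))
      (≤-trans (+-monoˡ-≤ ∣ D ∣ (∣p∪q∣≤∣p∣+∣q∣ S X)) (cases (select-∈ sel D∈L)))
      where
      cases : D ≡ T ⊎ D ∈ˡ L′ → ∣ S ∣ + ∣ X ∣ + ∣ D ∣ ≤ ∣ T ∣ + size L′
      cases (inj₂ D∈L′) = ≤-trans (≤-reflexive (+-assoc (∣ S ∣) (∣ X ∣) (∣ D ∣))) (+-mono-≤ T≤ (bound D∈L′))
      -- If `D` is the tree just packed, `S` is charged to a remaining tree instead; there is one,
      -- because the hit for `L′` names it.
      cases (inj₁ refl) with find hit
      ... | T′ , T′∈L′ , _ = ≤-trans (≤-reflexive (+-comm (∣ S ∣ + ∣ X ∣) (∣ D ∣))) (+-monoʳ-≤ ∣ D ∣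
        (≤-trans (≤-reflexive (+-comm ∣ S ∣ ∣ X ∣))
          (≤-trans (+-monoʳ-≤ ∣ X ∣ (∣S∣≤ (select-⊆ sel T′∈L′))) (bound T′∈L′))))
    hit⁺ : Any (λ T → ¬ Model F G T (U ─ (S ∪ X))) L
    -- The tree missed in the rest is missed altogether: by the choice of `S`, no tree of `L` has a
    -- model in `A ─ S` either.
    hit⁺ with find hit
    ... | T′ , T′∈L′ , ¬M = lose T′∈L λ M′ →
        [ (λ inA → ¬Q (lose T′∈L inA)) , ¬M ]′ (model-splits (All.lookup trees T′∈L) ∂A⊆S M′)
      where
      T′∈L : T′ ∈ˡ L
      T′∈L = select-⊆ sel T′∈L′

-- Components of the forest

module _ (F : Graph) where

  Isolated : Subset (n F) → Set
  Isolated = Closed F (λ _ → Unit)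

  isolated-─ : ∀ {W C} → Isolated W → Isolated C → Isolated (W ─ C)
  isolated-─ {W} {C} W-isolated C-isolated x∈ e _ = x∈p∧x∉q⇒x∈p─q (W-isolated (p─q⊆p W C x∈) e tt)
    λ y∈C → x∈p─q⇒x∉q W C x∈ (C-isolated y∈C (edge-sym F e) tt)

  -- The components of `F` inside `W`, split off one by one. Both parts of each split are recorded
  -- as isolated, as `model-union` requires when the models are joined again.
  data Components : Subset (n F) → List (Subset (n F)) → Set where
    []   : ∀ {W} → Empty W → Components W []
    cons : ∀ {C W L} → Nonempty C × Connected F C → Isolated C → C ⊆ W → Isolated (W ─ C) →
           Components (W ─ C) L → Components W (C ∷ L)

  components-of : ∀ N W → ∣ W ∣ ≤ N → Isolated W → ∃ (Components W)
  components-of N W bound isolated with nonempty? W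
  ... | no empty = _ , [] empty
  components-of zero W bound isolated | yes (v , v∈W) =
    contradiction (≤-trans (x∈p⇒∣p-x∣<∣p∣ v∈W) bound) λ ()
  components-of (suc N) W bound isolated | yes (v , v∈W) with reach F {A = λ _ → Unit} (λ _ → yes tt) v
  ... | C , v∈C , walks , C-isolated
    with components-of N (W ─ C)
           (s≤s⁻¹ (≤-trans (p∩q≢∅⇒∣p─q∣<∣p∣ W C (v , x∈p∩q⁺ (v∈W , v∈C))) bound)) (isolated-─ isolated C-isolated)
  ... | L , comps = C ∷ L , cons ((v , v∈C) , C-connected) C-isolated
          (λ u∈C → closed-walk isolated v∈W (walks u∈C)) (isolated-─ isolated C-isolated) comps
    where
    from-v : ∀ {u} → u ∈ C → Walk F (_∈ C) v u
    from-v u∈C = closed-walk-inside C-isolated v∈C (walks u∈C)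
    C-connected : Connected F C
    C-connected u∈C w∈C = walk-++ (walk-reverse v∈C (from-v u∈C)) (from-v w∈C)

  components-trees : ∀ {W L} → Components W L → All (λ C → Nonempty C × Connected F C) L
  components-trees ([] _) = []
  components-trees (cons tree _ _ _ comps) = tree ∷ components-trees comps

  components-size : ∀ {W L} → Components W L → size L ≤ ∣ W ∣
  components-size ([] _) = z≤n
  components-size (cons {C} {W} _ _ C⊆W _ comps) =
    ≤-trans (+-monoʳ-≤ ∣ C ∣ (components-size comps)) (∣q∣+∣p─q∣≤∣p∣ W C C⊆W)

  components-cover : ∀ {W L v} → Components W L → v ∈ W → ∃ λ C → C ∈ˡ L × v ∈ C × Isolated C
  components-cover ([] empty) v∈W = contradiction (_ , v∈W) empty
  components-cover {v = v} (cons {C} _ C-isolated _ _ comps) v∈W with v ∈? C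
  ... | yes v∈C = C , here refl , v∈C , C-isolated
  ... | no v∉C with components-cover comps (x∈p∧x∉q⇒x∈p─q v∈W v∉C)
  ...   | D , D∈L , v∈D , D-isolated = D , there D∈L , v∈D , D-isolated

  -- No walk from `v` can leave the listed component that contains `v`, since that component is
  -- isolated.
  largest-component : ∀ {L c v} → Components ⊤ L → HasCard (Component F v) c → ∃ λ C → C ∈ˡ L × c ≤ ∣ C ∣
  largest-component comps (g , g-inj , g-range) with components-cover comps ∈⊤
  ... | C , C∈L , v∈C , C-isolated = C , C∈L , injection⇒≤∣p∣ C g g-inj λ i →
          closed-walk C-isolated v∈C (proj₂ (g-range (g i)) i refl)

-- From packed trees to disjoint forest minors

module _ {F G : Graph} where

  -- The models of the components in the initial segment `L` are disjoint and unite to a model of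
  -- `F` restricted to `W`; the remainder is still packed outside their union.
  unpack-copy : ∀ {W L L′ A} → Components F W L → Packing F G (L ++ L′) A →
    ∃ λ B → B ⊆ A × Model F G W B × Packing F G L′ (A ─ B)
  unpack-copy {L′ = L′} {A} ([] empty) packing =
    ⊥ , ⊥-elim ∘ ∉⊥ , ((λ _ → ⊥) , isModel-∅ empty) , subst (Packing F G L′) (≡-sym (p─⊥≡p A)) packing
  unpack-copy {L′ = L′} {A} (cons _ C-isolated _ W─C-isolated comps) (pack B B⊆A M packing)
    with unpack-copy comps packing
  ... | B′ , B′⊆ , M′ , packing′ =
    B ∪ B′ , (λ v∈ → [ B⊆A , p─q⊆p A B ∘ B′⊆ ]′ (x∈p∪q⁻ B B′ v∈)) ,
    model-union (λ x∈ e _ → C-isolated x∈ e tt) (λ x∈ e _ → W─C-isolated x∈ e tt)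
      (λ v∈B v∈B′ → x∈p─q⇒x∉q A B (B′⊆ v∈B′) v∈B) M M′ ,
    subst (Packing F G L′) (p─q─r≡p─q∪r A B B′) packing′

  unpack-copies : ∀ {L} → Components F ⊤ L → ∀ k {A} → Packing F G (concat (replicate k L)) A →
    Σ (Fin k → Subset (n G)) λ S → (∀ i → S i ⊆ A) ×
      (∀ i j v → i ≢ j → v ∈ S i → v ∉ S j) × (∀ i → Model F G ⊤ (S i))
  unpack-copies comps zero packing = (λ ()) , (λ ()) , (λ ()) , λ ()
  unpack-copies comps (suc k) {A} packing with unpack-copy comps packing
  ... | B , B⊆A , M , packing′ with unpack-copies comps k packing′
  ... | S , S⊆ , S-disjoint , Ms =
    (λ { zero → B ; (suc i) → S i }) ,
    (λ { zero → B⊆A ; (suc i) → p─q⊆p A B ∘ S⊆ i }) ,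
    (λ { zero zero v i≢j _ _ → i≢j refl
       ; zero (suc j) v _ v∈B v∈S → x∈p─q⇒x∉q A B (S⊆ j v∈S) v∈B
       ; (suc i) zero v _ v∈S v∈B → x∈p─q⇒x∉q A B (S⊆ i v∈S) v∈B
       ; (suc i) (suc j) v i≢j → S-disjoint i j v (i≢j ∘ cong suc) }) ,
    (λ { zero → M ; (suc i) → Ms i })

  model⇒minor : ∀ {A} → Model F G ⊤ A → HasMinor G A F
  model⇒minor (b , M) = record
    { branch = b ; inside = λ x v → inside ∈⊤ ; nonempty = λ x → nonempty ∈⊤
    ; disjoint = λ x y v x≢y v∈x v∈y → x≢y (disjoint ∈⊤ ∈⊤ v∈x v∈y)
    ; connected = λ x u v → connected ∈⊤ ; edges = λ x y → edges ∈⊤ ∈⊤ }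
    where open IsModel M

  minor⇒model : ∀ {A C} → HasMinor G A F → Model F G C A
  minor⇒model M = branch , record
    { inside = λ _ → inside _ _ ; nonempty = λ _ → nonempty _
    ; disjoint = λ {x} {y} {v} _ _ v∈x v∈y → decidable-stable (x ≟ y) λ x≢y → disjoint x y v x≢y v∈x v∈y
    ; connected = λ _ → connected _ _ _ ; edges = λ _ _ → edges _ _ }
    where open MinorModel M

-- Counting vertices and the final bound

size-++ : ∀ {N} (L L′ : List (Subset N)) → size (L ++ L′) ≡ size L + size L′
size-++ L L′ = trans (cong sum (map-++ ∣_∣ L L′)) (sum-++ (map ∣_∣ L) (map ∣_∣ L′))

size-copies : ∀ {N} k (L : List (Subset N)) → size (concat (replicate k L)) ≡ k * size L
size-copies zero L = refl
size-copies (suc k) L = trans (size-++ L (concat (replicate k L))) (cong (size L +_) (size-copies k L))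

theorem2 : (F : Graph) → IsForest F → (t' : ℕ) → MaxComponentSize F t' →
    (k : ℕ) → 1 ≤ k → (G : Graph) →
    DisjointMinors G F k ⊎
    Σ (Subset (n G)) (λ X → (∣ X ∣ ≤ n F * k ∸ t') × ¬ HasMinor G (∁ X) F)
theorem2 F forest t' (_ , t'-attained) k@(suc k-1) _ G
  with components-of F (n F) ⊤ (∣p∣≤n ⊤) (λ _ _ _ → ∈⊤)
... | L , comps
  with pack-or-hit F G forest _ (concat (replicate k L)) refl
         (concat⁺ (replicate⁺ k (components-trees F comps))) ⊤
... | inj₁ packing =
  let S , _ , S-disjoint , models = unpack-copies comps k packing
  in inj₁ (S , S-disjoint , model⇒minor ∘ models)
... | inj₂ (X , bound , hit) = inj₂ (X , m+n≤o⇒m≤o∸n ∣ X ∣ ∣X∣+t'≤ , hits)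
  where
  hits : ¬ HasMinor G (∁ X) F
  hits M with find hit
  -- A model of `F` restricts to a model of the missed tree `T`.
  ... | T , _ , ¬M = ¬M (model-mono (λ v∈ → x∈p∧x∉q⇒x∈p─q ∈⊤ (x∈∁p⇒x∉p v∈)) (minor⇒model M))
  -- As `k` is positive, the list starts with a full copy of `L`, where a largest component is
  -- found. For empty `F` the value of `t'` is zero and any tree of the list will do.
  large : (n F ≡ 0 × t' ≡ 0) ⊎ (∃ λ v → HasCard (Component F v) t') →
    ∃ λ C → C ∈ˡ concat (replicate k L) × t' ≤ ∣ C ∣
  large (inj₁ (_ , refl)) = let T , T∈ , _ = find hit in T , T∈ , z≤n
  large (inj₂ (v , card)) = let C , C∈L , t'≤ = largest-component F comps card in C , ∈-++⁺ˡ C∈L , t'≤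
  ∣X∣+t'≤ : ∣ X ∣ + t' ≤ n F * k
  ∣X∣+t'≤ with large t'-attained
  ... | C , C∈ , t'≤ = ≤-trans (+-monoʳ-≤ ∣ X ∣ t'≤) (≤-trans (bound C∈)
    (≤-trans (≤-reflexive (size-copies k L))
      (≤-trans (*-monoʳ-≤ k (≤-trans (components-size F comps) (∣p∣≤n ⊤))) (≤-reflexive (*-comm k (n F))))))
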